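{- Let $\Delta=\Delta(n)$ satisfy $\Delta\ge 3$ and $\Delta=o(n^{1/2})$. Any algorithm that, given a vertex set $V$ with $|V|=n$ and a distance oracle for an unknown connected graph $G=(V,E)$ of maximum degree at most $\Delta$, always outputs $E$, must make $\Omega(\Delta n\log n/\log\log n)$ distance queries on some such graph $G$.
   Context: A distance oracle for $G$ receives a pair $(u,v)\in V^2$ and returns the number of edges on a shortest path between $u$ and $v$ in $G$. Graphs are unweighted, undirected and simple. -}

module Defs where

open import Data.Bool using (Bool; true; false)
open import Data.Fin using (Fin)
open import Data.Fin.Subset using (Subset; ∣_∣)
open import Data.Nat using (ℕ; zero; suc; _*_; _^_; _≤_)
open import Data.Nat.Logarithm using (⌊log₂_⌋; ⌈log₂_⌉)
open import Data.Product using (∃-syntax; _×_)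
open import Data.Vec using (tabulate)
open import Relation.Binary.PropositionalEquality using (_≡_)

-- f = o(n^{1/2}): for every ε = 1/k, eventually f n ≤ ε √n.
-- The inequality k · f n ≤ √n is squared in order to stay in ℕ.
IsLittleO-√ : (ℕ → ℕ) → Set
IsLittleO-√ f = ∀ k → ∃[ N ] (∀ n → N ≤ n → (k * f n) ^ 2 ≤ n)

record Graph (n : ℕ) : Set where
  field
    adj    : Fin n → Fin n → Bool
    sym    : ∀ u v → adj u v ≡ adj v u
    irrefl : ∀ u → adj u u ≡ false

open Graph public using (adj)

module _ {n : ℕ} (G : Graph n) where

  neighbours : Fin n → Subset n
  neighbours u = tabulate (adj G u)

  degree : Fin n → ℕ
  degree u = ∣ neighbours u ∣

  MaxDegreeAtMost : ℕ → Set
  MaxDegreeAtMost Δ = ∀ u → degree u ≤ Δ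

  data Walk : Fin n → Fin n → ℕ → Set where
    []  : ∀ {u} → Walk u u zero
    _∷_ : ∀ {u v w ℓ} → adj G u v ≡ true → Walk v w ℓ → Walk u w (suc ℓ)

  Connected : Set
  Connected = ∀ u v → ∃[ ℓ ] Walk u v ℓ

  -- A walk of minimum length repeats no vertex, so it is a shortest path.
  IsDistance : Fin n → Fin n → ℕ → Set
  IsDistance u v d = Walk u v d × (∀ {ℓ} → Walk u v ℓ → d ≤ ℓ)

Oracle : ℕ → Set
Oracle n = Fin n → Fin n → ℕ

IsDistanceOracle : ∀ {n} → Graph n → Oracle n → Set
IsDistanceOracle G dist = ∀ u v → IsDistance G u v (dist u v)

-- An algorithm on the vertex set Fin n is an adaptive decision tree: each
-- query may depend on all earlier answers, and computation between queries is
-- unrestricted and free. The output is the indicator function of an edge set.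
data Algorithm (n : ℕ) : Set where
  output : (Fin n → Fin n → Bool) → Algorithm n
  query  : (u v : Fin n) → (ℕ → Algorithm n) → Algorithm n

run : ∀ {n} → Algorithm n → Oracle n → Fin n → Fin n → Bool
run (output E)        dist = E
run (query u v next)  dist = run (next (dist u v)) dist

queryCount : ∀ {n} → Algorithm n → Oracle n → ℕ
queryCount (output E)        dist = zero
queryCount (query u v next)  dist = suc (queryCount (next (dist u v)) dist)

-- Correctness is only required on connected graphs of maximum degree at most Δ,
-- so the algorithm may exploit this promise (and knowledge of n and Δ).
Reconstructs : ∀ {n} → ℕ → Algorithm n → Set
Reconstructs {n} Δ A =
  (G : Graph n) → Connected G → MaxDegreeAtMost G Δ →
  (dist : Oracle n) → IsDistanceOracle G dist →
  ∀ u v → run A dist u v ≡ adj G u v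

-- q ≥ (1/k) · Δ n log n / log log n, multiplied out. Logarithms are to base 2;
-- the numerator is rounded up and the denominator down (⌊log₂⌊log₂ n⌋⌋ equals
-- ⌊log₂ log₂ n⌋), so for n ≥ 4 this implies the real inequality with the same k.
-- For n ≥ 4 the rounding changes the quotient by at most a constant factor.
AtLeastBound : (k Δ n q : ℕ) → Set
AtLeastBound k Δ n q = Δ * n * ⌈log₂ n ⌉ ≤ k * q * ⌊log₂ ⌊log₂ n ⌋ ⌋

{-# OPTIONS --safe #-}
module Submission where

open import Data.Bool using (true; false)
import Data.Bool as Bool
open import Data.Empty using (⊥-elim)
open import Data.Fin using (Fin; zero; suc; toℕ; fromℕ<; combine; finToFun; funToFin; punchIn; _↑ˡ_; _↑ʳ_; splitAt)
open import Data.Fin.Properties using (toℕ<n; toℕ-fromℕ<; toℕ-injective; toℕ-↑ʳ; any?; injective⇒≤; suc-injective; splitAt-↑ˡ; splitAt-↑ʳ; ↑ˡ-injective; ↑ʳ-injective; combine-injective; combine-surjective; punchIn-injective; punchInᵢ≢i; funToFin-finToFin)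
import Data.Fin.Properties as Fin
open import Data.Fin.Subset using (Subset; ∣_∣)
open import Data.List using (List; []; _∷_; length; filter; allFin)
open import Data.List.Membership.Propositional using (_∈_)
open import Data.List.Membership.Propositional.Properties using (∈-filter⁻)
open import Data.List.Properties using (length-tabulate)
open import Data.List.Relation.Binary.Sublist.Propositional.Properties using (filter-⊆; filter⁺; length-mono-≤)
open import Data.List.Relation.Unary.All using (_∷_)
open import Data.List.Relation.Unary.AllPairs using (_∷_)
open import Data.List.Relation.Unary.Any using (here; there)
open import Data.List.Relation.Unary.Unique.Propositional using (Unique)
import Data.List.Relation.Unary.Unique.Propositional.Properties as Unique
open import Data.Nat using (ℕ; zero; suc; _+_; _*_; _∸_; _^_; _/_; _%_; _≤_; _<_; z≤n; s≤s; z<s; s≤s⁻¹; ≢-nonZero; >-nonZero; _≟_; _⊔_; ⌊_/2⌋)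
open import Data.Nat.DivMod using (m≡m%n+[m/n]*n; m%n<n; m/n*n≤m; m*n/n≡m; /-monoˡ-≤)
open import Data.Nat.Induction using (<-rec)
open import Data.Nat.Logarithm using (⌊log₂_⌋; ⌈log₂_⌉; ⌊log₂⌋-mono-≤; ⌈log₂⌉-mono-≤; ⌊log₂[2^n]⌋≡n; ⌈log₂2^n⌉≡n; ⌊log₂⌊n/2⌋⌋≡⌊log₂n⌋∸1)
open import Data.Nat.Properties hiding (_≟_; suc-injective)
import Data.Nat.Properties as ℕ
open import Data.Nat.Tactic.RingSolver using (solve-∀)
open import Data.Product using (∃-syntax; _×_; _,_; proj₁; proj₂)
open import Data.Sum using (_⊎_; inj₁; inj₂; [_,_]′; swap)
open import Data.Vec using (lookup; _∷_)
open import Data.Vec.Properties using (lookup∘tabulate)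
open import Function using (_∘_; mk⇔)
open import Function.Definitions using (Injective)
open import Relation.Binary.PropositionalEquality
open import Relation.Nullary using (Dec; yes; no; ¬_; does; ¬?)
open import Relation.Nullary.Decidable using (map′; _×-dec_; _⊎-dec_; dec-true; dec-false; does-⇔)
open import Relation.Unary using (Decidable)
open import Defs

-- On every vertex set there is a binary tree of logarithmic depth, whose leaves keep
-- Δ − 1 free slots each. Joining d = Δ − 1 blocks of r leaves to d blocks of 2r other
-- leaves, each pair of blocks by an arbitrary matching, gives at least r ^ (d * d * r)
-- connected graphs of maximum degree Δ in which all distances are at most 2 log n.
-- An adversary that always gives the most frequent answer thus divides the number of
-- candidates by at most 2 log n + 1 per query, so at least d² r log r / log (2 log n + 1)
-- queries are needed. With r = ⌊n / 8d⌋, which is at least of order √n because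
-- Δ = o(√n), this is Ω(Δ n log n / log log n).

-- Pigeonhole and the adversary argument.

module _ {A : Set} where

  length≡filter+filter¬ : ∀ {P : A → Set} (P? : Decidable P) xs →
    length xs ≡ length (filter P? xs) + length (filter (¬? ∘ P?) xs)
  length≡filter+filter¬ P? []       = refl
  length≡filter+filter¬ P? (x ∷ xs) with does (P? x)
  ... | true  = cong suc (length≡filter+filter¬ P? xs)
  ... | false = trans (cong suc (length≡filter+filter¬ P? xs)) (sym (+-suc _ _))

  -- Pigeonhole by induction on `D`: removing the fibre of the top value leaves one value fewer. The
  -- larger of this fibre and the one found in the remainder serves for the whole list.
  popular-value : (f : A → ℕ) (D : ℕ) (xs : List A) → (∀ {x} → x ∈ xs → f x < D) →
    ∃[ a ] length xs ≤ D * length (filter (λ x → f x ≟ a) xs)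
  popular-value f zero    []       f<D = 0 , z≤n
  popular-value f zero    (x ∷ xs) f<D with () ← f<D (here refl)
  popular-value f (suc D) xs       f<D = choose (≤-total (size D) (size a))
    where
    size : ℕ → ℕ
    size a = length (filter (λ x → f x ≟ a) xs)

    D? : Decidable (λ x → f x ≡ D)
    D? x = f x ≟ D

    rest : List A
    rest = filter (¬? ∘ D?) xs

    f<D-on-rest : ∀ {x} → x ∈ rest → f x < D
    f<D-on-rest x∈rest with x∈xs , fx≢D ← ∈-filter⁻ (¬? ∘ D?) x∈rest =
      ≤∧≢⇒< (s≤s⁻¹ (f<D x∈xs)) fx≢D

    a : ℕ
    a = proj₁ (popular-value f D rest f<D-on-rest)

    size-bound : length xs ≤ size D + D * size a
    size-bound = begin
      length xs             ≡⟨ length≡filter+filter¬ D? xs ⟩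
      size D + length rest  ≤⟨ +-monoʳ-≤ (size D) (proj₂ (popular-value f D rest f<D-on-rest)) ⟩
      size D + D * length (filter (λ x → f x ≟ a) rest)
        -- The induction counts `a` only within `rest`; as a sublist of `xs`, this yields at most
        -- the count in `xs`.
        ≤⟨ +-monoʳ-≤ (size D) (*-monoʳ-≤ D (length-mono-≤
             (filter⁺ (λ x → f x ≟ a) (λ x → f x ≟ a) (λ { refl p → p }) (filter-⊆ (¬? ∘ D?) xs)))) ⟩
      size D + D * size a   ∎
      where open ≤-Reasoning

    choose : size D ≤ size a ⊎ size a ≤ size D → ∃[ a ] length xs ≤ suc D * size a
    choose (inj₁ le) = a , ≤-trans size-bound (+-monoˡ-≤ (D * size a) le)
    choose (inj₂ le) = D , ≤-trans size-bound (+-monoʳ-≤ (size D) (*-monoʳ-≤ D le))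

module _ {C : Set} {n : ℕ} (dist : C → Oracle n) (D : ℕ) (dist<D : ∀ c u v → dist c u v < D) where

  -- The list `cs` holds the candidates consistent with all answers so far. The last hypothesis says
  -- that the output must tell them apart, so a single one is left at an output node, while each
  -- query costs at most a factor `D`. The survivor `c` is a genuine input whose oracle gives
  -- exactly the answers chosen.
  adversary : (A : Algorithm n) (cs : List C) → Unique cs → 0 < length cs →
    (∀ {c c′} → c ∈ cs → c′ ∈ cs →
      (∀ u v → run A (dist c) u v ≡ run A (dist c′) u v) → c ≡ c′) →
    ∃[ c ] (c ∈ cs × length cs ≤ D ^ queryCount A (dist c))
  adversary (output E) (c ∷ [])      uniq pos sep = c , here refl , ≤-refl
  adversary (output E) (c ∷ c′ ∷ cs) ((c≢c′ ∷ _) ∷ _) pos sep =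
    ⊥-elim (c≢c′ (sep (here refl) (there (here refl)) (λ u v → refl)))
  adversary (query u v next) cs uniq pos sep
    with a , |cs|≤ ← popular-value (λ c → dist c u v) D cs (λ {c} _ → dist<D c u v)
    = extend (adversary (next a) cs′ (Unique.filter⁺ a? uniq) pos′ sep′)
    where
    a? : Decidable (λ c → dist c u v ≡ a)
    a? c = dist c u v ≟ a

    cs′ : List C
    cs′ = filter a? cs

    -- An empty fibre would bound the length of `cs` by `D * 0`.
    pos′ : 0 < length cs′
    pos′ = n≢0⇒n>0 λ eq → <⇒≱ pos
      (≤-trans |cs|≤ (≤-reflexive (trans (cong (D *_) eq) (*-zeroʳ D))))

    sep′ : ∀ {c c′} → c ∈ cs′ → c′ ∈ cs′ →
      (∀ u v → run (next a) (dist c) u v ≡ run (next a) (dist c′) u v) → c ≡ c′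
    sep′ c∈ c′∈ same
      with c∈cs , dc≡a ← ∈-filter⁻ a? c∈ | c′∈cs , dc′≡a ← ∈-filter⁻ a? c′∈
      = sep c∈cs c′∈cs (λ x y → trans (cong (λ a → run (next a) _ x y) dc≡a)
          (trans (same x y) (cong (λ a → run (next a) _ x y) (sym dc′≡a))))

    extend : ∃[ c ] (c ∈ cs′ × length cs′ ≤ D ^ queryCount (next a) (dist c)) →
      ∃[ c ] (c ∈ cs × length cs ≤ D ^ queryCount (query u v next) (dist c))
    -- Matching on `refl` identifies the adversary's answer with the true answer of `c`, so the two
    -- query counts differ by exactly one.
    extend (c , c∈cs′ , bound) with c∈cs , refl ← ∈-filter⁻ a? c∈cs′ =
      c , c∈cs , ≤-trans |cs|≤ (*-monoʳ-≤ D bound)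

-- Walks and the existence of distances.

least : ∀ {P : ℕ → Set} → Decidable P → ∀ m → P m → ∃[ d ] (P d × (∀ {j} → P j → d ≤ j))
least P? zero    p = 0 , p , λ _ → z≤n
least P? (suc m) p with P? 0
... | yes p₀ = 0 , p₀ , λ _ → z≤n
... | no ¬p₀ with d , pd , d-min ← least (P? ∘ suc) m p =
  suc d , pd , λ { {zero} p₀ → ⊥-elim (¬p₀ p₀) ; {suc j} pj → s≤s (d-min pj) }

module _ {n : ℕ} (G : Graph n) where

  -- Decidability for each fixed length lets `least` extract a shortest walk, so that actual oracles
  -- can be exhibited.
  walk? : ∀ u v → Decidable (Walk G u v)
  walk? u v zero    = map′ (λ { refl → [] }) (λ { [] → refl }) (u Fin.≟ v)
  walk? u v (suc ℓ) = map′ (λ (w , e , p) → e ∷ p) (λ { (e ∷ p) → _ , e , p })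
    (any? λ w → (adj G u w Bool.≟ true) ×-dec walk? w v ℓ)

  _++ʷ_ : ∀ {u v w k ℓ} → Walk G u v k → Walk G v w ℓ → Walk G u w (k + ℓ)
  []      ++ʷ q = q
  (e ∷ p) ++ʷ q = e ∷ (p ++ʷ q)

  snoc : ∀ {u v w ℓ} → Walk G u v ℓ → adj G v w ≡ true → Walk G u w (suc ℓ)
  snoc []      e = e ∷ []
  snoc (f ∷ p) e = f ∷ snoc p e

  reverseʷ : ∀ {u v ℓ} → Walk G u v ℓ → Walk G v u ℓ
  reverseʷ []      = []
  reverseʷ (e ∷ p) = snoc (reverseʷ p) (trans (Graph.sym G _ _) e)

  shortest : ∀ {u v ℓ} → Walk G u v ℓ → ∃[ d ] IsDistance G u v d
  shortest p = least (walk? _ _) _ p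

-- Degree bounds from labelled edge ends.

members : ∀ {n} (p : Subset n) → Fin ∣ p ∣ → Fin n
members (true  ∷ p) zero    = zero
members (true  ∷ p) (suc i) = suc (members p i)
members (false ∷ p) i       = suc (members p i)

members-injective : ∀ {n} (p : Subset n) → Injective _≡_ _≡_ (members p)
members-injective (true  ∷ p) {zero}  {zero}  eq = refl
members-injective (true  ∷ p) {suc i} {suc j} eq = cong suc (members-injective p (suc-injective eq))
members-injective (false ∷ p)                 eq = members-injective p (suc-injective eq)

lookup-members : ∀ {n} (p : Subset n) i → lookup p (members p i) ≡ true
lookup-members (true  ∷ p) zero    = refl
lookup-members (true  ∷ p) (suc i) = lookup-members p i
lookup-members (false ∷ p) i       = lookup-members p i

-- Composing the enumeration of the neighbours with the labelling by ports gives an injection into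
-- `Fin k`.
degree≤ : ∀ {n k} (G : Graph n) u (port : ∀ v → adj G u v ≡ true → Fin k) →
  (∀ {v w} e f → port v e ≡ port w f → v ≡ w) → degree G u ≤ k
degree≤ G u port port-injective =
  injective⇒≤ {f = λ i → port (members p i) (adjacent i)}
    (members-injective p ∘ port-injective _ _)
  where
  p : Subset _
  p = neighbours G u

  adjacent : ∀ i → adj G u (members p i) ≡ true
  adjacent i = trans (sym (lookup∘tabulate (adj G u) (members p i))) (lookup-members p i)

-- Codes for injections and for families of functions.

-- A variant of Lehmer codes: since the image of zero avoids the first suc r
-- values, the remaining r arguments keep enough room.
inject : ∀ {r t} → (Fin r → Fin t) → Fin r → Fin (r + t)
inject {suc r} f zero    = suc r ↑ʳ f zero
inject {suc r} f (suc i) = punchIn (suc r ↑ʳ f zero) (inject (f ∘ suc) i)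

inject-injective : ∀ {r t} (f : Fin r → Fin t) → Injective _≡_ _≡_ (inject f)
inject-injective f {zero}  {zero}  eq = refl
inject-injective f {zero}  {suc j} eq = ⊥-elim (punchInᵢ≢i _ _ (sym eq))
inject-injective f {suc i} {zero}  eq = ⊥-elim (punchInᵢ≢i _ _ eq)
inject-injective f {suc i} {suc j} eq =
  cong suc (inject-injective (f ∘ suc) (punchIn-injective _ _ _ eq))

-- The image of `zero` reveals `f zero`; after that the same `punchIn` can be cancelled on both
-- sides. Hence there are at least `t ^ r` injections from `Fin r` to `Fin (r + t)`.
inject-faithful : ∀ {r t} (f g : Fin r → Fin t) → (∀ i → inject f i ≡ inject g i) → ∀ i → f i ≡ g i
inject-faithful {suc r} f g eq zero    = ↑ʳ-injective (suc r) _ _ (eq zero)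
inject-faithful {suc r} f g eq (suc i) = inject-faithful (f ∘ suc) (g ∘ suc)
  (λ j → punchIn-injective (suc r ↑ʳ f zero) _ _
    (trans (eq (suc j)) (cong (λ x → punchIn (suc r ↑ʳ x) _) (sym (inject-faithful f g eq zero))))) i

funToFin-cong : ∀ {m n} {f g : Fin m → Fin n} → (∀ i → f i ≡ g i) → funToFin f ≡ funToFin g
funToFin-cong {zero}  eq = refl
funToFin-cong {suc m} eq = cong₂ combine (eq zero) (funToFin-cong (eq ∘ suc))

finToFun-injective : ∀ {m n} (c c′ : Fin (m ^ n)) →
  (∀ i → finToFun {m} {n} c i ≡ finToFun {m} {n} c′ i) → c ≡ c′
finToFun-injective {m} {n} c c′ eq = begin
  c                             ≡⟨ funToFin-finToFin {n} {m} c ⟨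
  funToFin (finToFun {m} {n} c)  ≡⟨ funToFin-cong {n} {m} eq ⟩
  funToFin (finToFun {m} {n} c′) ≡⟨ funToFin-finToFin {n} {m} c′ ⟩
  c′                            ∎
  where open ≡-Reasoning

-- A heap-shaped tree with matchings between its leaves.

does⇒ : ∀ {A : Set} (a? : Dec A) → does a? ≡ true → A
does⇒ (yes a) _ = a

-- Applied to the predecessor of a vertex number, `q` is the parent in the heap and the two cases
-- tell a left child from a right one.
halve : ∀ w → ∃[ q ] (w ≡ 2 * q ⊎ w ≡ suc (2 * q))
halve zero    = 0 , inj₁ refl
halve (suc w) with halve w
... | q , inj₁ eq = q , inj₂ (cong suc eq)
... | q , inj₂ eq = suc q , inj₁ (trans (cong suc eq) (sym (*-suc 2 q)))

-- The binary tree is numbered like a heap: the children of u are 2u + 1 and 2u + 2,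
-- so that a vertex u is a leaf as soon as n ≤ 2u + 1.
module TreeWithMatchings {n e r s : ℕ}
  (L : Fin (2 + e) → Fin r → Fin n) (R : Fin (2 + e) → Fin s → Fin n)
  (L-injective : ∀ {i i′ x x′} → L i x ≡ L i′ x′ → i ≡ i′ × x ≡ x′)
  (R-injective : ∀ {j j′ y y′} → R j y ≡ R j′ y′ → j ≡ j′ × y ≡ y′)
  (L≢R : ∀ {i x j y} → L i x ≢ R j y)
  (L-leaf : ∀ i x → n ≤ suc (2 * toℕ (L i x)))
  (R-leaf : ∀ j y → n ≤ suc (2 * toℕ (R j y)))
  where

  leaf-childless : ∀ k {u v : Fin n} → n ≤ suc (2 * toℕ u) → toℕ v ≢ suc (k + 2 * toℕ u)
  leaf-childless k {v = v} u-leaf eq = <⇒≱ (toℕ<n v)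
    (≤-trans u-leaf (≤-trans (s≤s (m≤n+m _ k)) (≤-reflexive (sym eq))))

  L-childless : ∀ k {i x} {v : Fin n} → toℕ v ≢ suc (k + 2 * toℕ (L i x))
  L-childless k {i} {x} = leaf-childless k {L i x} (L-leaf i x)

  R-childless : ∀ k {j y} {v : Fin n} → toℕ v ≢ suc (k + 2 * toℕ (R j y))
  R-childless k {j} {y} = leaf-childless k {R j y} (R-leaf j y)

  module _ (π : Fin (2 + e) → Fin (2 + e) → Fin r → Fin s) where

    -- Arcs are oriented from parent to child and from the `L` side to the `R` side, so that the two
    -- ends of an edge can receive different ports.
    data Arc (u v : Fin n) : Set where
      left     : toℕ v ≡ suc (2 * toℕ u) → Arc u v
      right    : toℕ v ≡ suc (suc (2 * toℕ u)) → Arc u v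
      matching : ∀ i j x → u ≡ L i x → v ≡ R j (π i j x) → Arc u v

    Edge : Fin n → Fin n → Set
    Edge u v = Arc u v ⊎ Arc v u

    arc? : ∀ u v → Dec (Arc u v)
    arc? u v = map′
      [ left , [ right , (λ (i , j , x , p , q) → matching i j x p q) ]′ ]′
      (λ { (left p) → inj₁ p ; (right p) → inj₂ (inj₁ p)
         ; (matching i j x p q) → inj₂ (inj₂ (i , j , x , p , q)) })
      ((toℕ v ≟ _) ⊎-dec ((toℕ v ≟ _) ⊎-dec
        any? λ i → any? λ j → any? λ x → (u Fin.≟ L i x) ×-dec (v Fin.≟ R j (π i j x))))

    edge? : ∀ u v → Dec (Edge u v)
    edge? u v = arc? u v ⊎-dec arc? v u

    arc-irreflexive : ∀ {u} → ¬ Arc u u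
    arc-irreflexive {u} (left p)  = <⇒≢ (s≤s (m≤m+n (toℕ u) _)) p
    arc-irreflexive {u} (right p) = <⇒≢ (s≤s (m≤n⇒m≤1+n (m≤m+n (toℕ u) _))) p
    arc-irreflexive (matching i j x p q) = L≢R (trans (sym p) q)

    graph : Graph n
    graph = record
      { adj    = λ u v → does (edge? u v)
      ; sym    = λ u v → does-⇔ (mk⇔ swap swap) (edge? u v) (edge? v u)
      ; irrefl = λ u → dec-false (edge? u u) [ arc-irreflexive , arc-irreflexive ]′
      }

    adj⇒edge : ∀ u v → adj graph u v ≡ true → Edge u v
    adj⇒edge u v = does⇒ (edge? u v)

    -- Port 0 leads to the parent. Ports 1 and 2 lead to the children of an inner vertex; at a leaf
    -- in a block the ports from 1 on are indexed by the blocks of the opposite side. This sharing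
    -- keeps the total at 1 + d = Δ.
    port : ∀ {u v} → Edge u v → Fin (3 + e)
    port (inj₁ (left _))             = suc zero
    port (inj₁ (right _))            = suc (suc zero)
    port (inj₁ (matching i j x _ _)) = suc j
    port (inj₂ (left _))             = zero
    port (inj₂ (right _))            = zero
    port (inj₂ (matching i j x _ _)) = suc i

    module _ (π-injective : ∀ i j → Injective _≡_ _≡_ (π i j)) where

      -- Child ports and matching ports never meet at one vertex, because block vertices are leaves.
      -- A matching port fixes the opposite block; the partner inside it is then unique because
      -- `π i j` is a function (seen from `L`) and injective (seen from `R`).
      port-injective : ∀ {u v w} (a : Edge u v) (b : Edge u w) → port a ≡ port b → v ≡ w
      port-injective (inj₁ (left p)) (inj₁ (left q)) eq = toℕ-injective (trans p (sym q))
      port-injective (inj₁ (left p)) (inj₁ (matching i j x refl _)) eq = ⊥-elim (L-childless 0 p)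
      port-injective (inj₁ (left p)) (inj₂ (matching i j x _ refl)) eq = ⊥-elim (R-childless 0 p)
      port-injective (inj₁ (right p)) (inj₁ (right q)) eq = toℕ-injective (trans p (sym q))
      port-injective (inj₁ (right p)) (inj₁ (matching i j x refl _)) eq = ⊥-elim (L-childless 1 p)
      port-injective (inj₁ (right p)) (inj₂ (matching i j x _ refl)) eq = ⊥-elim (R-childless 1 p)
      port-injective (inj₁ (matching i j x refl _)) (inj₁ (left p)) eq = ⊥-elim (L-childless 0 p)
      port-injective (inj₁ (matching i j x refl _)) (inj₁ (right p)) eq = ⊥-elim (L-childless 1 p)
      port-injective (inj₁ (matching i j x refl refl)) (inj₁ (matching i′ j′ x′ p refl)) refl
        with refl , refl ← L-injective p = refl
      port-injective (inj₁ (matching i j x refl _)) (inj₂ (matching i′ j′ x′ _ p)) eq = ⊥-elim (L≢R p)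
      port-injective (inj₂ (matching i j x _ refl)) (inj₁ (left p)) eq = ⊥-elim (R-childless 0 p)
      port-injective (inj₂ (matching i j x _ refl)) (inj₁ (right p)) eq = ⊥-elim (R-childless 1 p)
      port-injective (inj₂ (matching i j x _ refl)) (inj₁ (matching i′ j′ x′ p _)) eq = ⊥-elim (L≢R (sym p))
      port-injective (inj₂ (matching i j x refl refl)) (inj₂ (matching i′ j′ x′ refl p)) refl
        with refl , πx≡πx′ ← R-injective p = cong (L i) (π-injective i j πx≡πx′)
      port-injective (inj₂ (left _))  (inj₁ (left _)) ()
      port-injective (inj₂ (left _))  (inj₁ (right _)) ()
      port-injective (inj₂ (left _))  (inj₁ (matching _ _ _ _ _)) ()
      port-injective (inj₂ (right _)) (inj₁ (left _)) ()
      port-injective (inj₂ (right _)) (inj₁ (right _)) ()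
      port-injective (inj₂ (right _)) (inj₁ (matching _ _ _ _ _)) ()
      port-injective (inj₂ (left p)) (inj₂ (left q)) eq =
        toℕ-injective (*-cancelˡ-≡ _ _ 2 (ℕ.suc-injective (trans (sym p) q)))
      port-injective {v = v} {w} (inj₂ (left p)) (inj₂ (right q)) eq =
        ⊥-elim (even≢odd (toℕ v) (toℕ w) (ℕ.suc-injective (trans (sym p) q)))
      port-injective {v = v} {w} (inj₂ (right p)) (inj₂ (left q)) eq =
        ⊥-elim (even≢odd (toℕ w) (toℕ v) (ℕ.suc-injective (trans (sym q) p)))
      port-injective (inj₂ (right p)) (inj₂ (right q)) eq =
        toℕ-injective (*-cancelˡ-≡ _ _ 2 (ℕ.suc-injective (ℕ.suc-injective (trans (sym p) q))))

      degree-bound : MaxDegreeAtMost graph (3 + e)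
      degree-bound u = degree≤ graph u (λ v → port ∘ adj⇒edge u v)
        (λ {v} {w} a b → port-injective (adj⇒edge u v a) (adj⇒edge u w b))

    parent : ∀ {v} w → toℕ v ≡ suc w →
      ∃[ u ] (adj graph v u ≡ true × suc (2 * toℕ u) ≤ toℕ v)
    parent {v} w eq with q , w≡ ← halve w =
      u , dec-true (edge? v u) (inj₂ (arc w≡)) , ≤-trans (s≤s 2u≤w) (≤-reflexive (sym eq))
      where
      2q≤w : 2 * q ≤ w
      2q≤w = [ ≤-reflexive ∘ sym , (λ p → ≤-trans (n≤1+n _) (≤-reflexive (sym p))) ]′ w≡

      q<n : q < n
      q<n = ≤-<-trans (≤-trans (m≤m+n q _) 2q≤w) (<-trans (≤-reflexive (sym eq)) (toℕ<n v))

      u : Fin n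
      u = fromℕ< q<n

      u≡q : toℕ u ≡ q
      u≡q = toℕ-fromℕ< q<n

      2u≤w : 2 * toℕ u ≤ w
      2u≤w = subst (λ q → 2 * q ≤ w) (sym u≡q) 2q≤w

      arc : w ≡ 2 * q ⊎ w ≡ suc (2 * q) → Arc u v
      arc (inj₁ p) = left  (trans eq (cong suc (trans p (cong (2 *_) (sym u≡q)))))
      arc (inj₂ p) = right (trans eq (cong suc (trans p (cong (λ q → suc (2 * q)) (sym u≡q)))))

    -- Passing to the parent at least halves v + 1, since 2 (u + 1) ≤ v + 1. The root is described
    -- by its number because `n` is not syntactically a successor.
    walk-to-root : ∀ ℓ v → suc (toℕ v) < 2 ^ suc ℓ →
      ∃[ ρ ] ∃[ k ] (toℕ ρ ≡ 0 × k ≤ ℓ × Walk graph v ρ k)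
    walk-to-root ℓ v v< with toℕ v ≟ 0
    walk-to-root ℓ v v< | yes v≡0 = v , 0 , v≡0 , z≤n , []
    walk-to-root zero v (s≤s (s≤s v≤0)) | no v≢0 = ⊥-elim (v≢0 (n≤0⇒n≡0 v≤0))
    walk-to-root (suc ℓ) v v< | no v≢0
      with u , vu , 2u<v ← parent _ (sym (suc-pred (toℕ v) {{≢-nonZero v≢0}}))
      with ρ , k , ρ≡0 , k≤ℓ , p ← walk-to-root ℓ u (*-cancelˡ-< 2 _ _ (≤-<-trans
             (≤-trans (≤-reflexive (*-suc 2 (toℕ u))) (s≤s 2u<v)) v<))
      = ρ , suc k , ρ≡0 , s≤s k≤ℓ , vu ∷ p

    -- The route through the root uses tree edges only, hence the bound is uniform in `π`.
    short-walk : ∀ ℓ → n < 2 ^ suc ℓ → ∀ u v → ∃[ k ] (k ≤ ℓ + ℓ × Walk graph u v k)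
    short-walk ℓ n< u v
      with ρ , k , ρ≡0 , k≤ℓ , p ← walk-to-root ℓ u (≤-<-trans (toℕ<n u) n<)
         | σ , l , σ≡0 , l≤ℓ , q ← walk-to-root ℓ v (≤-<-trans (toℕ<n v) n<)
      with refl ← toℕ-injective (trans ρ≡0 (sym σ≡0))
      = k + l , +-mono-≤ k≤ℓ l≤ℓ , _++ʷ_ graph p (reverseʷ graph q)

    matching-edge : ∀ i j x → adj graph (L i x) (R j (π i j x)) ≡ true
    matching-edge i j x = dec-true (edge? _ _) (inj₁ (matching i j x refl refl))

  -- A tree arc between two block vertices would give a leaf a child, so adjacency between `L` and
  -- `R` reads off `π`.
  matching-unique : ∀ π i j x y → Edge π (L i x) (R j y) → y ≡ π i j x
  matching-unique π i j x y (inj₁ (left p))  = ⊥-elim (L-childless 0 p)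
  matching-unique π i j x y (inj₁ (right p)) = ⊥-elim (L-childless 1 p)
  matching-unique π i j x y (inj₁ (matching i′ j′ x′ p q))
    with refl , refl ← L-injective p | refl , refl ← R-injective q = refl
  matching-unique π i j x y (inj₂ (left p))  = ⊥-elim (R-childless 0 p)
  matching-unique π i j x y (inj₂ (right p)) = ⊥-elim (R-childless 1 p)
  matching-unique π i j x y (inj₂ (matching i′ j′ x′ p q)) = ⊥-elim (L≢R q)

  graph-faithful : ∀ π π′ → (∀ u v → adj (graph π) u v ≡ adj (graph π′) u v) →
    ∀ i j x → π i j x ≡ π′ i j x
  graph-faithful π π′ eq i j x = matching-unique π′ i j x _
    (adj⇒edge π′ (L i x) (R j (π i j x)) (trans (sym (eq (L i x) (R j (π i j x)))) (matching-edge π i j x)))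

-- Counting the family against the number of possible answers.

many-queries : ∀ {n} b e r ℓ → let d = 2 + e in
  n ≡ b + (d * r + d * (r + r)) → d * r + d * (r + r) ≤ b → n < 2 ^ suc ℓ → 0 < r →
  (A : Algorithm n) → Reconstructs (3 + e) A →
  ∃[ G ] ∃[ dist ] (Connected {n} G × MaxDegreeAtMost G (3 + e) × IsDistanceOracle G dist ×
    r ^ (d * (d * r)) ≤ suc (ℓ + ℓ) ^ queryCount A dist)
many-queries b e r ℓ refl m≤b n< 0<r A correct =
  let c , _ , bound = adversary dist (suc (ℓ + ℓ)) dist< A (allFin K)
        (Unique.allFin⁺ K) 0<|codes| separated
  in G c , dist c , connected c , degree-bound (π c) (π-injective c) , dist-correct c ,
     ≤-trans (≤-reflexive (sym (length-tabulate {n = K} (λ i → i)))) bound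
  where
  d K n : ℕ
  d = 2 + e
  K = r ^ (d * (d * r))
  n = b + (d * r + d * (r + r))

  -- The block vertices are the last ones in the heap, after `b` others: first the left blocks of
  -- size `r`, then the right blocks of size 2r.
  L : Fin d → Fin r → Fin n
  L i x = b ↑ʳ (combine i x ↑ˡ (d * (r + r)))

  R : Fin d → Fin (r + r) → Fin n
  R j y = b ↑ʳ ((d * r) ↑ʳ combine j y)

  L-injective : ∀ {i i′ x x′} → L i x ≡ L i′ x′ → i ≡ i′ × x ≡ x′
  L-injective eq = combine-injective _ _ _ _ (↑ˡ-injective _ _ _ (↑ʳ-injective b _ _ eq))

  R-injective : ∀ {j j′ y y′} → R j y ≡ R j′ y′ → j ≡ j′ × y ≡ y′
  R-injective eq = combine-injective _ _ _ _ (↑ʳ-injective (d * r) _ _ (↑ʳ-injective b _ _ eq))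

  L≢R : ∀ {i x j y} → L i x ≢ R j y
  L≢R {i} {x} {j} {y} eq
    with () ← trans (sym (splitAt-↑ˡ (d * r) (combine i x) (d * (r + r))))
      (trans (cong (splitAt (d * r)) (↑ʳ-injective b _ _ eq)) (splitAt-↑ʳ (d * r) _ (combine j y)))

  -- At least half of all vertices precede the blocks, so any child of a block vertex would have a
  -- number beyond `n`.
  leaf : ∀ (w : Fin (d * r + d * (r + r))) → n ≤ suc (2 * toℕ (b ↑ʳ w))
  leaf w = begin
    n                     ≤⟨ +-monoʳ-≤ b m≤b ⟩
    b + b                 ≤⟨ +-mono-≤ b≤ (≤-trans b≤ (m≤m+n _ 0)) ⟩
    2 * toℕ (b ↑ʳ w)      ≤⟨ n≤1+n _ ⟩
    suc (2 * toℕ (b ↑ʳ w)) ∎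
    where
    open ≤-Reasoning
    b≤ : b ≤ toℕ (b ↑ʳ w)
    b≤ = ≤-trans (m≤m+n b (toℕ w)) (≤-reflexive (sym (toℕ-↑ʳ b w)))

  open TreeWithMatchings {e = e} L R L-injective R-injective
    (λ {i} {x} {j} {y} → L≢R {i} {x} {j} {y}) (λ _ _ → leaf _) (λ _ _ → leaf _)

  -- A code has d * d * r digits in base `r`, one for each pair of blocks and each vertex of the
  -- left block.
  digit : Fin K → Fin d → Fin d → Fin r → Fin r
  digit c i j x = finToFun {r} {d * (d * r)} c (combine i (combine j x))

  π : Fin K → Fin d → Fin d → Fin r → Fin (r + r)
  π c i j = inject (digit c i j)

  π-injective : ∀ c i j → Injective _≡_ _≡_ (π c i j)
  π-injective c i j = inject-injective (digit c i j)

  π-faithful : ∀ c c′ → (∀ i j x → π c i j x ≡ π c′ i j x) → c ≡ c′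
  π-faithful c c′ eq = finToFun-injective {r} {d * (d * r)} c c′ λ z →
    let i , jx , z≡ = combine-surjective z
        j , x , jx≡ = combine-surjective jx
        z≡ijx = trans (sym z≡) (cong (combine i) (sym jx≡))
    in trans (cong (finToFun {r} {d * (d * r)} c) z≡ijx)
         (trans (inject-faithful (digit c i j) (digit c′ i j) (eq i j) x)
           (cong (finToFun {r} {d * (d * r)} c′) (sym z≡ijx)))

  G : Fin K → Graph n
  G c = graph (π c)

  connected : ∀ c → Connected (G c)
  connected c u v = let k , _ , p = short-walk (π c) ℓ n< u v in k , p

  dist : Fin K → Oracle n
  dist c u v = proj₁ (shortest (G c) (proj₂ (connected c u v)))

  dist-correct : ∀ c → IsDistanceOracle (G c) (dist c)
  dist-correct c u v = proj₂ (shortest (G c) (proj₂ (connected c u v)))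

  dist< : ∀ c u v → dist c u v < suc (ℓ + ℓ)
  dist< c u v = let _ , k≤ , p = short-walk (π c) ℓ n< u v
    in s≤s (≤-trans (proj₂ (dist-correct c u v) p) k≤)

  0<|codes| : 0 < length (allFin K)
  0<|codes| = <-≤-trans (m^n>0 r {{>-nonZero 0<r}} (d * (d * r)))
    (≤-reflexive (sym (length-tabulate {n = K} (λ i → i))))

  -- By correctness equal outputs mean equal graphs, hence equal matchings and equal codes.
  separated : ∀ {c c′} → c ∈ allFin K → c′ ∈ allFin K →
    (∀ u v → run A (dist c) u v ≡ run A (dist c′) u v) → c ≡ c′
  separated {c} {c′} _ _ same = π-faithful c c′ (graph-faithful (π c) (π c′) λ u v →
    trans (sym (reconstructed c u v)) (trans (same u v) (reconstructed c′ u v)))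
    where
    reconstructed : ∀ c u v → run A (dist c) u v ≡ adj (G c) u v
    reconstructed c = correct (G c) (connected c)
      (degree-bound (π c) (π-injective c)) (dist c) (dist-correct c)

-- Estimates for powers of two and rounded logarithms.

2^-cancel-≤ : ∀ a b → 2 ^ a ≤ 2 ^ b → a ≤ b
2^-cancel-≤ a b le = ≮⇒≥ λ b<a → <⇒≱ (^-monoʳ-< 2 (s≤s (s≤s z≤n)) b<a) le

square-cancel-≤ : ∀ a b → a * a ≤ b * b → a ≤ b
square-cancel-≤ a b le = ≮⇒≥ λ b<a → <⇒≱ (*-mono-< b<a b<a) le

2*⌊n/2⌋≤n : ∀ n → 2 * ⌊ n /2⌋ ≤ n
2*⌊n/2⌋≤n zero          = z≤n
2*⌊n/2⌋≤n (suc zero)    = z≤n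
2*⌊n/2⌋≤n (suc (suc n)) = ≤-trans (≤-reflexive (*-suc 2 ⌊ n /2⌋)) (s≤s (s≤s (2*⌊n/2⌋≤n n)))

n≤1+2*⌊n/2⌋ : ∀ n → n ≤ suc (2 * ⌊ n /2⌋)
n≤1+2*⌊n/2⌋ zero          = z≤n
n≤1+2*⌊n/2⌋ (suc zero)    = ≤-refl
n≤1+2*⌊n/2⌋ (suc (suc n)) = ≤-trans (s≤s (s≤s (n≤1+2*⌊n/2⌋ n)))
  (≤-reflexive (cong suc (sym (*-suc 2 ⌊ n /2⌋))))

2^⌊log₂n⌋≤n : ∀ n → 0 < n → 2 ^ ⌊log₂ n ⌋ ≤ n
2^⌊log₂n⌋≤n = <-rec _ step
  where
  step : ∀ n → (∀ {m} → m < n → 0 < m → 2 ^ ⌊log₂ m ⌋ ≤ m) → 0 < n → 2 ^ ⌊log₂ n ⌋ ≤ n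
  step (suc zero)        rec _ = ≤-reflexive (cong (2 ^_) (⌊log₂[2^n]⌋≡n 0))
  step n@(suc (suc m)) rec _ = begin
    -- The truncated subtraction only enlarges the exponent, so this step does not ask for a
    -- positive logarithm.
    2 ^ ⌊log₂ n ⌋            ≤⟨ ^-monoʳ-≤ 2 (m≤n+m∸n ⌊log₂ n ⌋ 1) ⟩
    2 * 2 ^ (⌊log₂ n ⌋ ∸ 1)  ≡⟨ cong (λ k → 2 * 2 ^ k) (⌊log₂⌊n/2⌋⌋≡⌊log₂n⌋∸1 n) ⟨
    2 * 2 ^ ⌊log₂ ⌊ n /2⌋ ⌋  ≤⟨ *-monoʳ-≤ 2 (rec (⌊n/2⌋<n (suc m)) z<s) ⟩
    2 * ⌊ n /2⌋              ≤⟨ 2*⌊n/2⌋≤n n ⟩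
    n                        ∎
    where open ≤-Reasoning

n<2^[1+⌊log₂n⌋] : ∀ n → n < 2 ^ suc ⌊log₂ n ⌋
n<2^[1+⌊log₂n⌋] n = ≰⇒> λ le → 1+n≰n
  (≤-trans (≤-reflexive (sym (⌊log₂[2^n]⌋≡n (suc ⌊log₂ n ⌋)))) (⌊log₂⌋-mono-≤ le))

⌈log₂n⌉≤1+⌊log₂n⌋ : ∀ n → ⌈log₂ n ⌉ ≤ suc ⌊log₂ n ⌋
⌈log₂n⌉≤1+⌊log₂n⌋ n = ≤-trans (⌈log₂⌉-mono-≤ (<⇒≤ (n<2^[1+⌊log₂n⌋] n)))
  (≤-reflexive (⌈log₂2^n⌉≡n (suc ⌊log₂ n ⌋)))

2^k≤n⇒k≤⌊log₂n⌋ : ∀ k {n} → 2 ^ k ≤ n → k ≤ ⌊log₂ n ⌋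
2^k≤n⇒k≤⌊log₂n⌋ k le = ≤-trans (≤-reflexive (sym (⌊log₂[2^n]⌋≡n k))) (⌊log₂⌋-mono-≤ le)

-- Choice of the parameters and the constant.

module Parameters (n e : ℕ) (4≤n : 4 ≤ n) (Δ²-bound : (8 * (3 + e)) ^ 2 ≤ n) where

  open ≤-Reasoning

  -- Here `h` stands in for log r: half of log n suffices since `r` is at least of order √n. The
  -- iterated logarithm is `m`.
  d ℓ h m r : ℕ
  d = 2 + e
  ℓ = ⌊log₂ n ⌋
  h = ⌊ ℓ /2⌋
  m = ⌊log₂ ℓ ⌋
  r = n / (8 * d)

  2≤ℓ : 2 ≤ ℓ
  2≤ℓ = 2^k≤n⇒k≤⌊log₂n⌋ 2 4≤n

  1≤m : 1 ≤ m
  1≤m = 2^k≤n⇒k≤⌊log₂n⌋ 1 2≤ℓ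

  1≤h : 1 ≤ h
  1≤h = ⌊n/2⌋-mono 2≤ℓ

  -- After squaring, both factors are at most `n`: the first as 2h ≤ ℓ, the second by the bound on
  -- Δ, which enters only here.
  8d2^h≤n : 2 ^ h * (8 * d) ≤ n
  8d2^h≤n = square-cancel-≤ _ _ (begin
    (2 ^ h * (8 * d)) * (2 ^ h * (8 * d))  ≡⟨ square-* (2 ^ h) (8 * d) ⟩
    (2 ^ h * 2 ^ h) * ((8 * d) ^ 2)        ≡⟨ cong (_* (8 * d) ^ 2) (^-distribˡ-+-* 2 h h) ⟨
    2 ^ (h + h) * (8 * d) ^ 2
      ≤⟨ *-mono-≤ (^-monoʳ-≤ 2 h+h≤ℓ) (^-monoˡ-≤ 2 (*-monoʳ-≤ 8 (n≤1+n d))) ⟩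
    2 ^ ℓ * (8 * (3 + e)) ^ 2              ≤⟨ *-mono-≤ (2^⌊log₂n⌋≤n n (≤-trans z<s 4≤n)) Δ²-bound ⟩
    n * n                                  ∎)
    where
    square-* : ∀ a b → (a * b) * (a * b) ≡ (a * a) * (b * (b * 1))
    square-* = solve-∀

    h+h≤ℓ : h + h ≤ ℓ
    h+h≤ℓ = subst (_≤ ℓ) (cong (h +_) (+-identityʳ h)) (2*⌊n/2⌋≤n ℓ)

  2^h≤r : 2 ^ h ≤ r
  2^h≤r = begin
    2 ^ h                        ≡⟨ m*n/n≡m (2 ^ h) (8 * d) ⟨
    2 ^ h * (8 * d) / (8 * d)    ≤⟨ /-monoˡ-≤ (8 * d) 8d2^h≤n ⟩
    r                            ∎

  0<r : 0 < r
  0<r = <-≤-trans (m^n>0 2 h) 2^h≤r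

  8dr≤n : r * (8 * d) ≤ n
  8dr≤n = m/n*n≤m n (8 * d)

  n≤16dr : n ≤ 16 * (d * r)
  n≤16dr = begin
    n                              ≡⟨ m≡m%n+[m/n]*n n (8 * d) ⟩
    n % (8 * d) + r * (8 * d)      ≤⟨ +-monoˡ-≤ _ (<⇒≤ (m%n<n n (8 * d))) ⟩
    8 * d + r * (8 * d)            ≤⟨ +-monoˡ-≤ _ (m≤n*m (8 * d) r {{>-nonZero 0<r}}) ⟩
    r * (8 * d) + r * (8 * d)      ≡⟨ eq r d ⟩
    16 * (d * r)                   ∎
    where
    eq : ∀ r d → r * (8 * d) + r * (8 * d) ≡ 16 * (d * r)
    eq = solve-∀

  terminals : ℕ
  terminals = d * r + d * (r + r)

  2terminals≤n : terminals + terminals ≤ n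
  2terminals≤n = begin
    -- There are 3dr terminals, so twice their number is 6dr, which leaves a slack of 2dr below 8dr.
    terminals + terminals              ≤⟨ m≤m+n _ (2 * (d * r)) ⟩
    terminals + terminals + 2 * (d * r)  ≡⟨ eq r d ⟩
    r * (8 * d)                        ≤⟨ 8dr≤n ⟩
    n                                  ∎
    where
    eq : ∀ r d → d * r + d * (r + r) + (d * r + d * (r + r)) + 2 * (d * r) ≡ r * (8 * d)
    eq = solve-∀

  terminals≤n : terminals ≤ n
  terminals≤n = ≤-trans (m≤m+n terminals terminals) 2terminals≤n

  terminals≤n∸terminals : terminals ≤ n ∸ terminals
  terminals≤n∸terminals = m+n≤o⇒m≤o∸n terminals 2terminals≤n

  1+2ℓ≤2^3m : suc (ℓ + ℓ) ≤ 2 ^ (3 * m)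
  1+2ℓ≤2^3m = begin
    suc (ℓ + ℓ)      ≤⟨ s≤s (+-monoʳ-≤ ℓ (n≤1+n ℓ)) ⟩
    suc ℓ + suc ℓ    ≡⟨ cong (suc ℓ +_) (+-identityʳ (suc ℓ)) ⟨
    2 * suc ℓ        ≤⟨ *-monoʳ-≤ 2 (n<2^[1+⌊log₂n⌋] ℓ) ⟩
    2 ^ (2 + m)      ≤⟨ ^-monoʳ-≤ 2 (+-monoˡ-≤ m (*-monoʳ-≤ 2 1≤m)) ⟩
    2 ^ (2 * m + m)  ≡⟨ cong (2 ^_) (+-comm (2 * m) m) ⟩
    2 ^ (3 * m)      ∎

  1+ℓ≤4h : suc ℓ ≤ 4 * h
  1+ℓ≤4h = begin
    suc ℓ            ≤⟨ s≤s (n≤1+2*⌊n/2⌋ ℓ) ⟩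
    2 + 2 * h        ≤⟨ +-monoˡ-≤ (2 * h) (*-monoʳ-≤ 2 1≤h) ⟩
    2 * h + 2 * h    ≡⟨ *-distribʳ-+ h 2 2 ⟨
    4 * h            ∎

  -- The constant is 384 = 2 · 16 · 4 · 3, from Δ ≤ 2d, n ≤ 16dr, ℓ + 1 ≤ 4h and 2ℓ + 1 ≤ 2 ^ (3m).
  at-least-bound : ∀ q → r ^ (d * (d * r)) ≤ suc (ℓ + ℓ) ^ q → AtLeastBound 384 (3 + e) n q
  at-least-bound q counting = begin
    (3 + e) * n * ⌈log₂ n ⌉
      ≤⟨ *-mono-≤ (*-mono-≤ Δ≤2d n≤16dr) (≤-trans (⌈log₂n⌉≤1+⌊log₂n⌋ n) 1+ℓ≤4h) ⟩
    2 * d * (16 * (d * r)) * (4 * h)   ≡⟨ eq₁ d r h ⟩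
    128 * (h * (d * (d * r)))          ≤⟨ *-monoʳ-≤ 128 exponents ⟩
    128 * (3 * m * q)                  ≡⟨ eq₂ m q ⟩
    384 * q * m                        ∎
    where
    eq₁ : ∀ d r h → 2 * d * (16 * (d * r)) * (4 * h) ≡ 128 * (h * (d * (d * r)))
    eq₁ = solve-∀

    eq₂ : ∀ m q → 128 * (3 * m * q) ≡ 384 * q * m
    eq₂ = solve-∀

    Δ≤2d : 3 + e ≤ 2 * d
    Δ≤2d = +-mono-≤ {1} {d} (s≤s z≤n) (≤-reflexive (sym (+-identityʳ d)))

    -- Both sides of the counting inequality are compared with powers of two, which amounts to
    -- taking logarithms.
    exponents : h * (d * (d * r)) ≤ 3 * m * q
    exponents = 2^-cancel-≤ _ _ (begin
      2 ^ (h * (d * (d * r)))    ≡⟨ ^-*-assoc 2 h _ ⟨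
      (2 ^ h) ^ (d * (d * r))    ≤⟨ ^-monoˡ-≤ (d * (d * r)) 2^h≤r ⟩
      r ^ (d * (d * r))          ≤⟨ counting ⟩
      suc (ℓ + ℓ) ^ q            ≤⟨ ^-monoˡ-≤ q 1+2ℓ≤2^3m ⟩
      (2 ^ (3 * m)) ^ q          ≡⟨ ^-*-assoc 2 (3 * m) q ⟩
      2 ^ (3 * m * q)            ∎)

-- Assembling the bound.

large-degree-bound : ∀ n Δ → 3 ≤ Δ → 4 ≤ n → (8 * Δ) ^ 2 ≤ n →
  (A : Algorithm n) → Reconstructs Δ A →
  ∃[ G ] ∃[ dist ] (Connected {n} G × MaxDegreeAtMost G Δ × IsDistanceOracle G dist ×
    AtLeastBound 384 Δ n (queryCount A dist))
large-degree-bound n (suc (suc (suc e))) (s≤s (s≤s (s≤s z≤n))) 4≤n Δ²-bound A correct =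
  let G , dist , connected , degrees , distances , counting =
        many-queries (n ∸ terminals) e r ℓ (sym (m∸n+n≡m terminals≤n)) terminals≤n∸terminals
          (n<2^[1+⌊log₂n⌋] n) 0<r A correct
  in G , dist , connected , degrees , distances , at-least-bound (queryCount A dist) counting
  where open Parameters n e 4≤n Δ²-bound

theorem4 : (Δ : ℕ → ℕ) → (∀ n → 3 ≤ Δ n) → IsLittleO-√ Δ →
    ∃[ k ] ∃[ N ] (∀ n → N ≤ n →
    (A : Algorithm n) → Reconstructs (Δ n) A →
    ∃[ G ] ∃[ dist ]
    (Connected {n} G × MaxDegreeAtMost G (Δ n) × IsDistanceOracle G dist ×
    AtLeastBound k (Δ n) n (queryCount A dist)))
theorem4 Δ 3≤Δ Δ=o√ =
  -- The factor 8 is the one in r = ⌊n / 8d⌋; n ≥ 4 makes the iterated logarithm at least 1.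
  let N , eventually = Δ=o√ 8
  in 384 , 4 ⊔ N , λ n N≤n → large-degree-bound n (Δ n) (3≤Δ n)
       (≤-trans (m≤m⊔n 4 N) N≤n) (eventually n (≤-trans (m≤n⊔m 4 N) N≤n))
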